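{- For any graph $G$ with $\gamma_{t2}(G) \geq 3$, $ct_{\gamma_{t2}}(G) \leq 3$.
   Context: All graphs are finite, simple and connected. A semitotal dominating set of a graph $G$ is a set $D\subseteq V(G)$ such that every vertex of $V(G)\setminus D$ has a neighbour in $D$ and every vertex of $D$ is at distance at most two in $G$ from some other vertex of $D$; $\gamma_{t2}(G)$ denotes the minimum size of a semitotal dominating set of $G$. Contracting an edge $uv$ means deleting $u$ and $v$ and adding a new vertex adjacent to every neighbour of $u$ or $v$. $ct_{\gamma_{t2}}(G)$ is the smallest integer $k$ such that there is a set of $k$ edges of $G$ whose contraction yields a graph $G'$ with $\gamma_{t2}(G')<\gamma_{t2}(G)$. -}

module Defs where

open import Data.Bool.Base using (Bool; false; T; _∨_)
open import Data.Bool.Properties using (T-∨)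
open import Data.Empty using (⊥-elim)
open import Data.Fin.Base using (Fin; zero; suc; punchIn; punchOut) renaming (_<_ to _<ᶠ_)
open import Data.Fin.Properties using (_≟_; punchIn-punchOut; punchOut-injective)
open import Data.Fin.Subset using (Subset; _∈_; _∉_; ∣_∣)
open import Data.List.Base using (List; length; foldl)
open import Data.List.Relation.Unary.Unique.Propositional using (Unique)
open import Data.Nat.Base using (ℕ; zero; suc; _≤_; _<_)
open import Data.Product.Base using (∃-syntax; _×_; _,_)
open import Data.Sum.Base using (_⊎_; inj₁; inj₂)
open import Function.Base using (_∘_; id)
open import Function.Bundles using (Equivalence)
open import Relation.Binary.PropositionalEquality using (_≡_; _≢_; refl; sym; trans; cong; subst)
open import Relation.Nullary.Decidable.Core using (yes; no)

record Graph (n : ℕ) : Set where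
  field
    adj        : Fin n → Fin n → Bool
    adj-sym    : ∀ u v → adj u v ≡ adj v u
    adj-irrefl : ∀ u → adj u u ≡ false

  Adj : Fin n → Fin n → Set
  Adj u v = T (adj u v)

  Adj⇒≢ : ∀ {u v} → Adj u v → u ≢ v
  Adj⇒≢ {u} uv refl = subst T (adj-irrefl u) uv

  data Walk (u : Fin n) : Fin n → ℕ → Set where
    here : Walk u u 0
    step : ∀ {v w k} → Walk u v k → Adj v w → Walk u w (suc k)

  DistanceAtMost : ℕ → Fin n → Fin n → Set
  DistanceAtMost d u v = ∃[ k ] k ≤ d × Walk u v k

  Connected : Set
  Connected = ∀ u v → ∃[ k ] Walk u v k

  record SemitotalDominating (D : Subset n) : Set where
    field
      dominating : ∀ v → v ∉ D → ∃[ w ] w ∈ D × Adj v w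
      semitotal  : ∀ v → v ∈ D → ∃[ w ] w ∈ D × w ≢ v × DistanceAtMost 2 v w

  -- An unordered edge is represented by its increasing pair of endpoints; both
  -- proof fields are propositions, so equal endpoints give equal edges.
  record Edge : Set where
    constructor mkEdge
    field
      src tgt : Fin n
      src<tgt : src <ᶠ tgt
      joined  : Adj src tgt

Least : (ℕ → Set) → ℕ → Set
Least P k = P k × (∀ j → P j → k ≤ j)

-- A graph with exactly one vertex has no semitotal dominating set, so its
-- semitotal domination number does not exist; hence the relational form.
IsSemitotalDominationNumber : ∀ {n} → Graph n → ℕ → Set
IsSemitotalDominationNumber G =
  Least λ k → ∃[ D ] Graph.SemitotalDominating G D × ∣ D ∣ ≡ k

-- Vertices of the contracted graph: zero is the new vertex and suc i is the
-- i-th vertex (old i) of G other than u and v.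
module Contraction {m} (G : Graph (suc (suc m))) {u v} (uv : Graph.Adj G u v) where
  open Graph G

  private
    u≢v : u ≢ v
    u≢v = Adj⇒≢ uv

  old : Fin m → Fin (suc (suc m))
  old i = punchIn u (punchIn (punchOut u≢v) i)

  contracted : Graph (suc m)
  contracted = record { adj = adj′ ; adj-sym = sym′ ; adj-irrefl = irrefl′ }
    where
    adj′ : Fin (suc m) → Fin (suc m) → Bool
    adj′ zero    zero    = false
    adj′ zero    (suc j) = adj u (old j) ∨ adj v (old j)
    adj′ (suc i) zero    = adj u (old i) ∨ adj v (old i)
    adj′ (suc i) (suc j) = adj (old i) (old j)

    sym′ : ∀ a b → adj′ a b ≡ adj′ b a
    sym′ zero    zero    = refl
    sym′ zero    (suc j) = refl
    sym′ (suc i) zero    = refl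
    sym′ (suc i) (suc j) = adj-sym (old i) (old j)

    irrefl′ : ∀ a → adj′ a a ≡ false
    irrefl′ zero    = refl
    irrefl′ (suc i) = adj-irrefl (old i)

  locate : ∀ x → (x ≡ u ⊎ x ≡ v) ⊎ (∃[ i ] old i ≡ x)
  locate x with x ≟ u | x ≟ v
  ... | yes x≡u | _       = inj₁ (inj₁ x≡u)
  ... | no  _   | yes x≡v = inj₁ (inj₂ x≡v)
  ... | no  x≢u | no  x≢v = inj₂ (punchOut p≢q ,
      trans (cong (punchIn u) (punchIn-punchOut p≢q)) (punchIn-punchOut (x≢u ∘ sym)))
    where
    p≢q : punchOut u≢v ≢ punchOut (x≢u ∘ sym)
    p≢q eq = x≢v (sym (punchOut-injective u≢v (x≢u ∘ sym) eq))

  project : Fin (suc (suc m)) → Fin (suc m)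
  project x with locate x
  ... | inj₁ _       = zero
  ... | inj₂ (i , _) = suc i

  project-adj : ∀ {x y} → Adj x y →
                project x ≡ project y ⊎ Graph.Adj contracted (project x) (project y)
  project-adj {x} {y} xy with locate x | locate y
  ... | inj₁ _           | inj₁ _           = inj₁ refl
  ... | inj₁ (inj₁ refl) | inj₂ (j , refl)  = inj₂ (Equivalence.from T-∨ (inj₁ xy))
  ... | inj₁ (inj₂ refl) | inj₂ (j , refl)  =
    inj₂ (Equivalence.from (T-∨ {adj u (old j)}) (inj₂ xy))
  ... | inj₂ (i , refl)  | inj₁ (inj₁ refl) =
    inj₂ (Equivalence.from T-∨ (inj₁ (subst T (adj-sym (old i) u) xy)))
  ... | inj₂ (i , refl)  | inj₁ (inj₂ refl) =
    inj₂ (Equivalence.from (T-∨ {adj u (old i)}) (inj₂ (subst T (adj-sym (old i) v) xy)))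
  ... | inj₂ (i , refl)  | inj₂ (j , refl)  = inj₂ xy

-- A graph obtained from G by successive edge contractions, with the induced
-- map on vertices: an edge of G either has collapsed or is still an edge.
record Contracted {n} (G : Graph n) : Set where
  field
    {size}    : ℕ
    graph     : Graph size
    image     : Fin n → Fin size
    image-adj : ∀ {x y} → Graph.Adj G x y →
                image x ≡ image y ⊎ Graph.Adj graph (image x) (image y)

module _ {n} {G : Graph n} where

  contractAdjacent : (C : Contracted G) → let open Contracted C in
                     ∀ {a b} → Graph.Adj graph a b → Contracted G
  contractAdjacent record { size = suc zero ; graph = H } {zero} {zero} ab =
    ⊥-elim (Graph.Adj⇒≢ H ab refl)
  contractAdjacent record { size = suc (suc m) ; graph = H ; image = π ; image-adj = π-adj } ab =
    record { graph = contracted ; image = project ∘ π ; image-adj = adjacent }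
    where
    open Contraction H ab
    adjacent : ∀ {x y} → Graph.Adj G x y →
               project (π x) ≡ project (π y) ⊎ Graph.Adj contracted (project (π x)) (project (π y))
    adjacent xy with π-adj xy
    ... | inj₁ eq = inj₁ (cong project eq)
    ... | inj₂ e  = project-adj e

  -- An edge whose endpoints have already been merged needs no contraction.
  contractEdge : Contracted G → Graph.Edge G → Contracted G
  contractEdge C e with Contracted.image-adj C (Graph.Edge.joined e)
  ... | inj₁ _  = C
  ... | inj₂ ab = contractAdjacent C ab

-- The edges are contracted one at a time; the order affects the result only up
-- to isomorphism.
contractEdges : ∀ {n} (G : Graph n) → List (Graph.Edge G) → Contracted G
contractEdges G = foldl contractEdge (record { graph = G ; image = id ; image-adj = inj₂ })

SemitotalDominationNumberDecreases : ∀ {m n} → Graph m → Graph n → Set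
SemitotalDominationNumberDecreases G′ G = ∃[ g′ ] ∃[ g ]
  IsSemitotalDominationNumber G′ g′ × IsSemitotalDominationNumber G g × g′ < g

IsContractionNumber : ∀ {n} → Graph n → ℕ → Set
IsContractionNumber G = Least λ k → ∃[ S ]
  Unique S × length S ≡ k ×
  SemitotalDominationNumberDecreases (Contracted.graph (contractEdges G S)) G

{-# OPTIONS --safe #-}

-- Let D be a semitotal dominating set with at least three vertices.  There is a
-- set Z of at most three vertices, inducing a connected subgraph, that contains
-- exactly two vertices x ≠ y of D: take x, a vertex y of D within distance two
-- of x, and, if x and y are not adjacent, a common neighbour c (replacing y by c
-- if c lies in D).  Walk from x to a third vertex of D.  Every vertex on the way
-- is dominated from inside or from outside Z, and where this changes there is a
-- path t, a, b, w with t ∈ Z and w ∈ D ∖ Z (two consecutive vertices may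
-- coincide).  Collapse Z, enlarged by a when w ≠ a; a spanning tree has at most
-- three edges.  The image of D still dominates and is smaller, since x and y are
-- identified.  Vertices of D outside the collapsed set keep their
-- semitotal witnesses, and the collapsed vertex has the image of w as a witness.
module Submission where

open import Defs
open import Data.Bool.Base using (T)
open import Data.Bool.Properties using (T?; T-irrelevant)
open import Data.Fin.Base using (Fin; zero; suc)
open import Data.Fin.Properties using (_≟_; _<?_; all?; any?; <-cmp; <-irrelevant; punchInᵢ≢i; punchIn-injective; punchIn-punchOut)
open import Data.Fin.Subset using (Subset; inside; outside; _∈_; _∉_; ∣_∣; ⊥; ⁅_⁆; _∪_; _-_)
open import Data.Fin.Subset.Properties using (_∈?_; anySubset?; p⊆q⇒∣p∣≤∣q∣; p─q⊆p; ∣⊥∣≡0; ∣⁅x⁆∣≡1; x∈⁅x⁆; x∈⁅y⁆⇒x≡y; x∈p∪q⁺; x∈p∪q⁻; ∉⊥; x∈p∧x≢y⇒x∈p-y; x∈p⇒∣p-x∣<∣p∣)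
open import Data.List.Base using (List; []; _∷_; _∷ʳ_; length)
open import Data.List.Properties using (foldl-∷ʳ; length-++)
import Data.List.Membership.DecPropositional as DecMembership
open import Data.List.Membership.Propositional using () renaming (_∈_ to _∈ˡ_; _∉_ to _∉ˡ_)
open import Data.List.Relation.Unary.All as All using (All; [])
import Data.List.Relation.Unary.All.Properties as All
open import Data.List.Relation.Unary.AllPairs using ([]; _∷_)
open import Data.List.Relation.Unary.Any using (here; there)
open import Data.List.Relation.Unary.Unique.Propositional using (Unique)
import Data.List.Relation.Unary.Unique.Propositional.Properties as Unique
import Data.List.Relation.Unary.Unique.DecPropositional as DecUnique
open import Data.Nat.Base using (ℕ; zero; suc; _+_; _≤_; _<_; z≤n; s≤s; s≤s⁻¹)
import Data.Nat.Properties as ℕ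
open import Data.Product.Base using (∃; ∃-syntax; _×_; _,_; proj₁; proj₂)
open import Data.Sum.Base using (_⊎_; inj₁; inj₂; map₂; swap)
open import Data.Vec.Base as Vec using ([]; _∷_)
open import Function.Base using (_∘_; id)
open import Relation.Binary.Definitions using (DecidableEquality; tri<; tri≈; tri>)
open import Relation.Binary.PropositionalEquality using (_≡_; _≢_; refl; sym; trans; cong; subst)
open import Relation.Nullary.Decidable using (Dec; yes; no; map′; _×-dec_; _→-dec_; ¬?; decidable-stable)
open import Relation.Nullary.Negation using (¬_; contradiction)

-- Least elements and decidable search

-- The bound by the witness `m` turns any explicit dominating set or edge list into an upper bound
-- for the minimum.
least : ∀ {P : ℕ → Set} → (∀ k → Dec (P k)) → ∀ {m} → P m →
        ∃[ k ] Least P k × k ≤ m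
least P? {zero} p = 0 , (p , λ _ _ → z≤n) , z≤n
least P? {suc m} p with P? 0
... | yes p₀ = 0 , (p₀ , λ _ _ → z≤n) , z≤n
... | no ¬p₀ with least (P? ∘ suc) p
... | k , (pₖ , k-min) , k≤m = suc k , (pₖ , minimal) , s≤s k≤m
  where
  minimal : ∀ j → _ → suc k ≤ j
  minimal zero    p₀ = contradiction p₀ ¬p₀
  minimal (suc j) pⱼ = s≤s (k-min j pⱼ)

Least-unique : ∀ {P j k} → Least P j → Least P k → j ≡ k
Least-unique (pⱼ , j-min) (pₖ , k-min) = ℕ.≤-antisym (j-min _ pₖ) (k-min _ pⱼ)

-- Exhaustive search as a property of a type, so that it passes from edges to edge lists of a fixed
-- length.
Searchable : Set → Set₁
Searchable A = ∀ {P : A → Set} → (∀ a → Dec (P a)) → Dec (∃ P)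

anyOfLength? : ∀ {A} → Searchable A → ∀ k {P : List A → Set} → (∀ xs → Dec (P xs)) →
               Dec (∃[ xs ] length xs ≡ k × P xs)
anyOfLength? search zero P? =
  map′ (λ p → [] , refl , p) (λ { ([] , refl , p) → p }) (P? [])
anyOfLength? search (suc k) P? =
  map′ (λ { (x , xs , eq , p) → x ∷ xs , cong suc eq , p })
       (λ { (x ∷ xs , eq , p) → x , xs , ℕ.suc-injective eq , p })
       (search λ x → anyOfLength? search k (P? ∘ (x ∷_)))

-- Cardinalities and images of subsets

∣p∪q∣≤∣p∣+∣q∣ : ∀ {n} (p q : Subset n) → ∣ p ∪ q ∣ ≤ ∣ p ∣ + ∣ q ∣
∣p∪q∣≤∣p∣+∣q∣ []            []            = z≤n
∣p∪q∣≤∣p∣+∣q∣ (outside ∷ p) (outside ∷ q) = ∣p∪q∣≤∣p∣+∣q∣ p q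
∣p∪q∣≤∣p∣+∣q∣ (outside ∷ p) (inside  ∷ q) =
  ℕ.≤-trans (s≤s (∣p∪q∣≤∣p∣+∣q∣ p q)) (ℕ.≤-reflexive (sym (ℕ.+-suc ∣ p ∣ ∣ q ∣)))
∣p∪q∣≤∣p∣+∣q∣ (inside  ∷ p) (outside ∷ q) = s≤s (∣p∪q∣≤∣p∣+∣q∣ p q)
∣p∪q∣≤∣p∣+∣q∣ (inside  ∷ p) (inside  ∷ q) =
  s≤s (ℕ.≤-trans (∣p∪q∣≤∣p∣+∣q∣ p q) (ℕ.+-monoʳ-≤ ∣ p ∣ (ℕ.n≤1+n ∣ q ∣)))

∣q∣<∣p∣⇒∃∈p∉q : ∀ {n} (p q : Subset n) → ∣ q ∣ < ∣ p ∣ → ∃[ x ] x ∈ p × x ∉ q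
∣q∣<∣p∣⇒∃∈p∉q p q q<p with any? (λ x → x ∈? p ×-dec ¬? (x ∈? q))
... | yes found = found
... | no  none  = contradiction (p⊆q⇒∣p∣≤∣q∣ p⊆q) (ℕ.<⇒≱ q<p)
  where
  p⊆q : ∀ {x} → x ∈ p → x ∈ q
  p⊆q {x} x∈p = decidable-stable (x ∈? q) (λ x∉q → none (x , x∈p , x∉q))

2<∣p∣⇒∃-third : ∀ {n} (p : Subset n) → 2 < ∣ p ∣ → ∀ x y →
                ∃[ z ] z ∈ p × z ≢ x × z ≢ y
2<∣p∣⇒∃-third p 2<p x y with ∣q∣<∣p∣⇒∃∈p∉q p (⁅ x ⁆ ∪ ⁅ y ⁆) (ℕ.≤-<-trans pair≤2 2<p)
  where
  pair≤2 : ∣ ⁅ x ⁆ ∪ ⁅ y ⁆ ∣ ≤ 2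
  pair≤2 = ℕ.≤-trans (∣p∪q∣≤∣p∣+∣q∣ ⁅ x ⁆ ⁅ y ⁆)
    (ℕ.+-mono-≤ (ℕ.≤-reflexive (∣⁅x⁆∣≡1 x)) (ℕ.≤-reflexive (∣⁅x⁆∣≡1 y)))
... | z , z∈p , z∉xy = z , z∈p
  , (λ { refl → z∉xy (x∈p∪q⁺ (inj₁ (x∈⁅x⁆ z))) })
  , (λ { refl → z∉xy (x∈p∪q⁺ (inj₂ (x∈⁅x⁆ z))) })

image : ∀ {m n} → (Fin m → Fin n) → Subset m → Subset n
image f []            = ⊥
image f (outside ∷ p) = image (f ∘ suc) p
image f (inside  ∷ p) = ⁅ f zero ⁆ ∪ image (f ∘ suc) p

∣image∣≤ : ∀ {m n} (f : Fin m → Fin n) p → ∣ image f p ∣ ≤ ∣ p ∣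
∣image∣≤ {n = n} f [] = ℕ.≤-reflexive (∣⊥∣≡0 n)
∣image∣≤ f (outside ∷ p) = ∣image∣≤ (f ∘ suc) p
∣image∣≤ f (inside  ∷ p) = ℕ.≤-trans (∣p∪q∣≤∣p∣+∣q∣ ⁅ f zero ⁆ _)
  (ℕ.+-mono-≤ (ℕ.≤-reflexive (∣⁅x⁆∣≡1 (f zero))) (∣image∣≤ (f ∘ suc) p))

∈-image⁺ : ∀ {m n} (f : Fin m → Fin n) p {x} → x ∈ p → f x ∈ image f p
∈-image⁺ f (inside  ∷ p) Vec.here        = x∈p∪q⁺ (inj₁ (x∈⁅x⁆ (f zero)))
∈-image⁺ f (outside ∷ p) (Vec.there x∈p) = ∈-image⁺ (f ∘ suc) p x∈p
∈-image⁺ f (inside  ∷ p) (Vec.there x∈p) = x∈p∪q⁺ (inj₂ (∈-image⁺ (f ∘ suc) p x∈p))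

∈-image⁻ : ∀ {m n} (f : Fin m → Fin n) p {y} → y ∈ image f p → ∃[ x ] x ∈ p × f x ≡ y
∈-image⁻ f [] y∈ = contradiction y∈ ∉⊥
∈-image⁻ f (outside ∷ p) y∈ with ∈-image⁻ (f ∘ suc) p y∈
... | x , x∈p , eq = suc x , Vec.there x∈p , eq
∈-image⁻ f (inside ∷ p) y∈ with x∈p∪q⁻ ⁅ f zero ⁆ _ y∈
... | inj₁ y∈₀ = zero , Vec.here , sym (x∈⁅y⁆⇒x≡y (f zero) y∈₀)
... | inj₂ y∈ₛ with ∈-image⁻ (f ∘ suc) p y∈ₛ
... | x , x∈p , eq = suc x , Vec.there x∈p , eq

-- Closed neighbourhoods and walks.

module _ {n} (G : Graph n) where
  open Graph G

  Adj-sym : ∀ {u v} → Adj u v → Adj v u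
  Adj-sym {u} {v} = subst T (adj-sym u v)

  Near : Fin n → Fin n → Set
  Near u v = u ≡ v ⊎ Adj u v

  Near-sym : ∀ {u v} → Near u v → Near v u
  Near-sym (inj₁ u≡v) = inj₁ (sym u≡v)
  Near-sym (inj₂ uv)  = inj₂ (Adj-sym uv)

  Near⇒distance≤2 : ∀ {u v w} → Near u v → Near v w → DistanceAtMost 2 u w
  Near⇒distance≤2 (inj₁ refl) (inj₁ refl) = 0 , z≤n , here
  Near⇒distance≤2 (inj₁ refl) (inj₂ vw)   = 1 , s≤s z≤n , step here vw
  Near⇒distance≤2 (inj₂ uv)   (inj₁ refl) = 1 , s≤s z≤n , step here uv
  Near⇒distance≤2 (inj₂ uv)   (inj₂ vw)   = 2 , ℕ.≤-refl , step (step here uv) vw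

  -- A discrete intermediate value argument, run backwards since walks grow at their end. `P` and
  -- `Q` may hold at the same vertex, so the change can happen without a step; hence `Near` and not
  -- `Adj`.
  walk-crossing : ∀ {P Q : Fin n → Set} → (∀ v → P v ⊎ Q v) →
                  ∀ {u w k} → Walk u w k → P u → Q w →
                  ∃[ a ] ∃[ b ] P a × Q b × Near a b
  walk-crossing P⊎Q here p q = _ , _ , p , q , inj₁ refl
  walk-crossing P⊎Q (step {v = v} walk vw) p q with P⊎Q v
  ... | inj₁ pᵥ = _ , _ , pᵥ , q , inj₂ vw
  ... | inj₂ qᵥ = walk-crossing P⊎Q walk p qᵥ

  -- Decidability

  walk? : ∀ u v k → Dec (Walk u v k)
  walk? u v zero = map′ (λ { refl → here }) (λ { here → refl }) (u ≟ v)
  walk? u w (suc k) = map′ (λ { (v , walk , vw) → step walk vw })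
                           (λ { (step walk vw) → _ , walk , vw })
                           (any? λ v → walk? u v k ×-dec T? (adj v w))

  distance≤? : ∀ d u v → Dec (DistanceAtMost d u v)
  distance≤? d u v = map′ (λ { (k , k<1+d , walk) → k , s≤s⁻¹ k<1+d , walk })
                          (λ { (k , k≤d , walk) → k , s≤s k≤d , walk })
                          (ℕ.anyUpTo? (walk? u v) (suc d))

  semitotalDominating? : ∀ D → Dec (SemitotalDominating D)
  semitotalDominating? D =
    map′ (λ { (dom , semi) → record { dominating = dom ; semitotal = semi } })
         (λ sd → SemitotalDominating.dominating sd , SemitotalDominating.semitotal sd)
         (all? (λ v → ¬? (v ∈? D) →-dec any? λ w → w ∈? D ×-dec T? (adj v w))
          ×-dec
          all? (λ v → v ∈? D →-dec
                any? λ w → w ∈? D ×-dec ¬? (w ≟ v) ×-dec distance≤? 2 v w))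

  mkEdge-cong : ∀ {a b a<b ab a<b′ ab′} → mkEdge a b a<b ab ≡ mkEdge a b a<b′ ab′
  mkEdge-cong {a<b = p} {q} {p′} {q′}
    with refl ← <-irrelevant p p′ | refl ← T-irrelevant q q′ = refl

  _≟ᵉ_ : DecidableEquality Edge
  mkEdge a b _ _ ≟ᵉ mkEdge a′ b′ _ _ =
    map′ (λ { (refl , refl) → mkEdge-cong }) (λ { refl → refl , refl })
         (a ≟ a′ ×-dec b ≟ b′)

  anyEdge? : Searchable Edge
  anyEdge? {P} P? =
    map′ (λ { (a , b , a<b , ab , p) → mkEdge a b a<b ab , p })
         (λ { (mkEdge a b a<b ab , p) → a , b , a<b , ab , p })
         (any? λ a → any? λ b → joined? a b)
    where
    joined? : ∀ a b → Dec (∃[ a<b ] ∃[ ab ] P (mkEdge a b a<b ab))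
    joined? a b with a <? b | T? (adj a b)
    ... | no a≮b  | _     = no (a≮b ∘ proj₁)
    ... | yes _   | no ¬e = no (¬e ∘ proj₁ ∘ proj₂)
    -- Proofs of order and of adjacency are unique, so testing `P` at this single edge settles the
    -- pair.
    ... | yes a<b | yes e = map′ (λ p → a<b , e , p)
                                 (λ { (_ , _ , p) → subst P mkEdge-cong p })
                                 (P? (mkEdge a b a<b e))

-- Existence of the domination and contraction numbers.

semitotalDominationNumber : ∀ {n} (G : Graph n) {D} → Graph.SemitotalDominating G D →
                            ∃[ γ ] IsSemitotalDominationNumber G γ × γ ≤ ∣ D ∣
semitotalDominationNumber G sd =
  least (λ k → anySubset? λ D → semitotalDominating? G D ×-dec ∣ D ∣ ℕ.≟ k)
        (_ , sd , refl)

module _ {m n} (G′ : Graph m) {G : Graph n} {γ} (isγ : IsSemitotalDominationNumber G γ) where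

  private
    Smaller : Set
    Smaller = ∃[ D ] Graph.SemitotalDominating G′ D × ∣ D ∣ < γ

  decreases⁺ : Smaller → SemitotalDominationNumberDecreases G′ G
  decreases⁺ (D , sd , D<γ) with semitotalDominationNumber G′ sd
  ... | γ′ , isγ′ , γ′≤D = γ′ , γ , isγ′ , isγ , ℕ.≤-<-trans γ′≤D D<γ

  -- A decrease comes with its own value for `G`; uniqueness of least elements identifies it with
  -- `γ`. The condition thus becomes a finite search over subsets.
  decreases⁻ : SemitotalDominationNumberDecreases G′ G → Smaller
  decreases⁻ (_ , _ , ((D , sd , refl) , _) , isg , D<g) =
    D , sd , subst (∣ D ∣ <_) (Least-unique isg isγ) D<g

  decreases? : Dec (SemitotalDominationNumberDecreases G′ G)
  decreases? = map′ decreases⁺ decreases⁻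
    (anySubset? λ D → semitotalDominating? G′ D ×-dec ∣ D ∣ ℕ.<? γ)

contractionNumber : ∀ {n} (G : Graph n) {γ} → IsSemitotalDominationNumber G γ →
  ∀ {S} → Unique S →
  SemitotalDominationNumberDecreases (Contracted.graph (contractEdges G S)) G →
  ∃[ k ] IsContractionNumber G k × k ≤ length S
contractionNumber G isγ unique decreases =
  least (λ k → map′ (λ { (S , len , u , d) → S , u , len , d })
                    (λ { (S , u , len , d) → S , len , u , d })
                    (anyOfLength? (anyEdge? G) k λ S →
                      unique? S ×-dec decreases? (Contracted.graph (contractEdges G S)) isγ))
        (_ , unique , refl , decreases)
  where open DecUnique (_≟ᵉ_ G) using (unique?)

-- Fibres of a contraction

module _ {m} (G : Graph (suc (suc m))) {u v} (uv : Graph.Adj G u v) where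
  open Contraction G uv

  private
    Endpoint : Fin (suc (suc m)) → Set
    Endpoint x = x ≡ u ⊎ x ≡ v

  old-not-endpoint : ∀ i → ¬ Endpoint (old i)
  old-not-endpoint i (inj₁ eq) = punchInᵢ≢i u _ eq
  old-not-endpoint i (inj₂ eq) = punchInᵢ≢i _ i
    (punchIn-injective u _ _ (trans eq (sym (punchIn-punchOut (Graph.Adj⇒≢ G uv)))))

  project-endpoint : ∀ {x} → Endpoint x → project x ≡ zero
  project-endpoint {x} x∈ with locate x
  ... | inj₁ _          = refl
  ... | inj₂ (i , refl) = contradiction x∈ (old-not-endpoint i)

  project-old : ∀ i → project (old i) ≡ suc i
  project-old i with locate (old i)
  ... | inj₁ i∈       = contradiction i∈ (old-not-endpoint i)
  ... | inj₂ (j , eq) =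
    cong suc (punchIn-injective _ j i (punchIn-injective u _ _ eq))

  project-reflects : ∀ {x y} → project x ≡ project y → x ≡ y ⊎ (Endpoint x × Endpoint y)
  project-reflects {x} {y} eq with locate x | locate y
  project-reflects eq   | inj₁ x∈         | inj₁ y∈         = inj₂ (x∈ , y∈)
  project-reflects refl | inj₂ (_ , refl) | inj₂ (_ , refl) = inj₁ refl

  project-surjective : ∀ z → ∃[ x ] project x ≡ z
  project-surjective zero    = u , project-endpoint (inj₁ refl)
  project-surjective (suc i) = old i , project-old i

-- Collapsing a vertex set along a spanning tree.

module _ {n} {G : Graph n} where
  open Graph G

  Surjective : Contracted G → Set
  Surjective C = let open Contracted C renaming (image to π) in ∀ z → ∃[ x ] π x ≡ z

  -- The effect of one contraction on the fibres over `G`: those of `a` and `b` are united and all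
  -- others stay. This also covers an edge already collapsed, where the two fibres coincide
  -- beforehand.
  record Merges (C C′ : Contracted G) (a b : Fin n) : Set where
    open Contracted C  renaming (image to π)
    open Contracted C′ renaming (image to π′)
    field
      preserves : ∀ {x y} → π x ≡ π y → π′ x ≡ π′ y
      merged    : π′ a ≡ π′ b
      reflects  : ∀ {x y} → π′ x ≡ π′ y → π x ≡ π y ⊎
                  ((π x ≡ π a ⊎ π x ≡ π b) × (π y ≡ π a ⊎ π y ≡ π b))
      surjective : Surjective C → Surjective C′

  contractAdjacent-merges : ∀ C {a b} → let open Contracted C renaming (image to π) in
    (ab : Graph.Adj graph (π a) (π b)) → Merges C (contractAdjacent C ab) a b
  contractAdjacent-merges record { size = zero ; image = π } {a} ab with () ← π a
  contractAdjacent-merges record { size = suc zero ; graph = H ; image = π } {a} {b} ab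
    with zero ← π a | zero ← π b = contradiction refl (Graph.Adj⇒≢ H ab)
  contractAdjacent-merges record { size = suc (suc m) ; graph = H ; image = π } ab = record
    { preserves  = cong project
    ; merged     = trans (project-endpoint H ab (inj₁ refl))
                         (sym (project-endpoint H ab (inj₂ refl)))
    ; reflects   = project-reflects H ab
    ; surjective = surjective
    }
    where
    open Contraction H ab
    surjective : (∀ z → ∃[ x ] π x ≡ z) → ∀ z → ∃[ x ] project (π x) ≡ z
    surjective π-onto z with project-surjective H ab z
    ... | y , refl with π-onto y
    ... | x , refl = x , refl

  contractEdge-merges : ∀ C e → Merges C (contractEdge C e) (Edge.src e) (Edge.tgt e)
  contractEdge-merges C e with Contracted.image-adj C (Edge.joined e)
  ... | inj₁ eq = record
    { preserves = id ; merged = eq ; reflects = inj₁ ; surjective = id }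
  ... | inj₂ ab = contractAdjacent-merges C ab

  -- An edge stores its endpoints in increasing order, while a tree grows from an old vertex to a
  -- new one, which may be either endpoint.
  Merges-swap : ∀ {C C′ a b} → Merges C C′ a b → Merges C C′ b a
  Merges-swap M = record
    { preserves  = preserves
    ; merged     = sym merged
    ; reflects   = λ eq → map₂ (λ { (x∈ , y∈) → swap x∈ , swap y∈ }) (reflects eq)
    ; surjective = surjective
    }
    where open Merges M

  -- The map is the quotient of the vertex set that shrinks `Z` to a point: all fibres other than
  -- `Z` are singletons.
  record Collapses (Z : List (Fin n)) (C : Contracted G) : Set where
    open Contracted C renaming (image to π)
    field
      merged     : ∀ {x y} → x ∈ˡ Z → y ∈ˡ Z → π x ≡ π y
      reflects   : ∀ {x y} → π x ≡ π y → x ≡ y ⊎ (x ∈ˡ Z × y ∈ˡ Z)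
      surjective : Surjective C

  -- Before the merge the fibre of `p` is `Z` and that of `q`, which lies outside `Z`, is a
  -- singleton; their union is the new fibre.
  Collapses-grow : ∀ {Z C C′ p q} → Collapses Z C → p ∈ˡ Z → q ∉ˡ Z →
                   Merges C C′ p q → Collapses (q ∷ Z) C′
  Collapses-grow {Z} {C} {C′} {p} {q} coll p∈Z q∉Z M = record
    { merged     = λ x∈ y∈ → trans (to-p x∈) (sym (to-p y∈))
    ; reflects   = reflects
    ; surjective = M.surjective C.surjective
    }
    where
    module C = Collapses coll
    module M = Merges M
    open Contracted C  renaming (image to π)
    open Contracted C′ renaming (image to π′)

    to-p : ∀ {x} → x ∈ˡ q ∷ Z → π′ x ≡ π′ p
    to-p (here refl) = sym M.merged
    to-p (there x∈Z) = M.preserves (C.merged x∈Z p∈Z)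

    absorbed : ∀ {x} → π x ≡ π p ⊎ π x ≡ π q → x ∈ˡ q ∷ Z
    absorbed (inj₁ eq) with C.reflects eq
    ... | inj₁ refl      = there p∈Z
    ... | inj₂ (x∈Z , _) = there x∈Z
    absorbed (inj₂ eq) with C.reflects eq
    ... | inj₁ refl      = here refl
    ... | inj₂ (_ , q∈Z) = contradiction q∈Z q∉Z

    reflects : ∀ {x y} → π′ x ≡ π′ y → x ≡ y ⊎ (x ∈ˡ q ∷ Z × y ∈ˡ q ∷ Z)
    reflects eq with M.reflects eq
    ... | inj₂ (x∈ , y∈) = inj₂ (absorbed x∈ , absorbed y∈)
    ... | inj₁ eq₀ with C.reflects eq₀
    ...   | inj₁ x≡y         = inj₁ x≡y
    ...   | inj₂ (x∈Z , y∈Z) = inj₂ (there x∈Z , there y∈Z)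

  -- Being a tree is expressed through its effect under contraction. `within` serves to show that
  -- each added edge is new.
  record SpanningTree (Z : List (Fin n)) (k : ℕ) : Set where
    field
      edges     : List Edge
      unique    : Unique edges
      size      : length edges ≡ k
      within    : All (λ e → Edge.src e ∈ˡ Z × Edge.tgt e ∈ˡ Z) edges
      collapses : Collapses Z (contractEdges G edges)

  singleton : ∀ x → SpanningTree (x ∷ []) 0
  singleton x = record
    { edges = [] ; unique = [] ; size = refl ; within = []
    ; collapses = record
      { merged = λ { (here refl) (here refl) → refl }
      ; reflects = inj₁
      ; surjective = λ z → z , refl
      }
    }

  grow-edge : ∀ {Z k p q} → SpanningTree Z k → p ∈ˡ Z → q ∉ˡ Z → (e : Edge) →
              (∀ C → Merges C (contractEdge C e) p q) →
              Edge.src e ∈ˡ q ∷ Z × Edge.tgt e ∈ˡ q ∷ Z →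
              ¬ (Edge.src e ∈ˡ Z × Edge.tgt e ∈ˡ Z) →
              SpanningTree (q ∷ Z) (suc k)
  grow-edge {Z} {q = q} T p∈Z q∉Z e M e⊆ e⊈ = record
    -- Appending at the end makes the fold contract `e` after all earlier edges, so `Collapses-grow`
    -- applies to the graph that they produce.
    { edges     = edges ∷ʳ e
    ; unique    = Unique.++⁺ unique ([] ∷ [])
        (λ { (e∈ , here refl) → e⊈ (All.lookup within e∈) })
    ; size      = trans (length-++ edges) (trans (ℕ.+-comm (length edges) 1) (cong suc size))
    ; within    = All.∷ʳ⁺ (All.map (λ { (s , t) → there s , there t }) within) e⊆
    ; collapses = subst (Collapses (q ∷ Z)) (sym (foldl-∷ʳ contractEdge _ e edges))
        (Collapses-grow collapses p∈Z q∉Z (M (contractEdges G edges)))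
    }
    where open SpanningTree T

  grow : ∀ {Z k p q} → SpanningTree Z k → p ∈ˡ Z → q ∉ˡ Z → Adj p q →
         SpanningTree (q ∷ Z) (suc k)
  grow {p = p} {q} T p∈Z q∉Z pq with <-cmp p q
  ... | tri< p<q _ _ = grow-edge T p∈Z q∉Z e (λ C → contractEdge-merges C e)
                         (there p∈Z , here refl) (q∉Z ∘ proj₂)
    where e = mkEdge p q p<q pq
  ... | tri≈ _ p≡q _ = contradiction p≡q (Adj⇒≢ pq)
  ... | tri> _ _ q<p = grow-edge T p∈Z q∉Z e (λ C → Merges-swap (contractEdge-merges C e))
                         (here refl , there p∈Z) (q∉Z ∘ proj₁)
    where e = mkEdge q p q<p (Adj-sym G pq)

  -- Image of a semitotal dominating set

  -- A step inside a fibre disappears and any other step survives, so contraction does not increase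
  -- distances.
  walk-image : (C : Contracted G) → let open Contracted C renaming (image to π) in
               ∀ {u v k} → Walk u v k → Graph.DistanceAtMost graph k (π u) (π v)
  walk-image C here = 0 , z≤n , Graph.here
  walk-image C {u} (step walk vw) with walk-image C walk | Contracted.image-adj C vw
  ... | j , j≤k , walk′ | inj₁ eq  =
    j , ℕ.m≤n⇒m≤1+n j≤k ,
    subst (λ z → Graph.Walk (Contracted.graph C) (Contracted.image C u) z j) eq walk′
  ... | j , j≤k , walk′ | inj₂ vw′ = suc j , s≤s j≤k , Graph.step walk′ vw′

  distance-image : (C : Contracted G) → let open Contracted C renaming (image to π) in
                   ∀ {d u v} → DistanceAtMost d u v → Graph.DistanceAtMost graph d (π u) (π v)
  distance-image C (k , k≤d , walk) with walk-image C walk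
  ... | j , j≤k , walk′ = j , ℕ.≤-trans j≤k k≤d , walk′

  module _ {D} (sd : SemitotalDominating D) where
    open SemitotalDominating sd
    open DecMembership (_≟_ {n}) using () renaming (_∈?_ to _∈ˡ?_)

    -- Dropping `y` before taking the image gives the strict inequality and loses no vertex of the
    -- image, since `x` has the same image.
    collapsed-dominating :
      ∀ {Z C} → Collapses Z C →
      ∀ {x y} → x ∈ˡ Z → y ∈ˡ Z → x ∈ D → y ∈ D → x ≢ y →
      ∀ {t w} → t ∈ˡ Z → w ∉ˡ Z → w ∈ D → DistanceAtMost 2 t w →
      ∃[ D′ ] Graph.SemitotalDominating (Contracted.graph C) D′ × ∣ D′ ∣ < ∣ D ∣
    collapsed-dominating {Z} {C} coll {x} {y} x∈Z y∈Z x∈D y∈D x≢y {t} {w} t∈Z w∉Z w∈D tw =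
      D′ , record { dominating = dominating′ ; semitotal = semitotal′ }
      , ℕ.≤-<-trans (∣image∣≤ π (D - y)) (x∈p⇒∣p-x∣<∣p∣ y∈D)
      where
      open Contracted C renaming (image to π)
      open Collapses coll

      D′ : Subset size
      D′ = image π (D - y)

      ∈D′⁺ : ∀ {v} → v ∈ D → π v ∈ D′
      ∈D′⁺ {v} v∈D with v ≟ y
      ... | no  v≢y  = ∈-image⁺ π (D - y) (x∈p∧x≢y⇒x∈p-y v∈D v≢y)
      ... | yes refl = subst (_∈ D′) (merged x∈Z y∈Z)
                         (∈-image⁺ π (D - y) (x∈p∧x≢y⇒x∈p-y x∈D x≢y))

      dominating′ : ∀ z → z ∉ D′ → ∃[ z′ ] z′ ∈ D′ × Graph.Adj graph z z′
      dominating′ z z∉ with surjective z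
      ... | v , refl with dominating v (z∉ ∘ ∈D′⁺)
      ... | u , u∈D , vu with image-adj vu
      ... | inj₁ eq  = contradiction (subst (_∈ D′) (sym eq) (∈D′⁺ u∈D)) z∉
      ... | inj₂ vu′ = π u , ∈D′⁺ u∈D , vu′

      semitotal′ : ∀ z → z ∈ D′ →
                   ∃[ z′ ] z′ ∈ D′ × z′ ≢ z × Graph.DistanceAtMost graph 2 z z′
      semitotal′ z z∈ with ∈-image⁻ π (D - y) z∈
      ... | v , v∈D-y , refl with v ∈ˡ? Z
      -- All of `Z` has one image, so the short walk from `t` serves for `v`.
      ... | yes v∈Z = π w , ∈D′⁺ w∈D , πw≢πv
            , subst (λ z → Graph.DistanceAtMost graph 2 z (π w)) (merged t∈Z v∈Z)
                (distance-image C tw)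
        where
        πw≢πv : π w ≢ π v
        πw≢πv eq with reflects eq
        ... | inj₁ refl      = w∉Z v∈Z
        ... | inj₂ (w∈Z , _) = w∉Z w∈Z
      -- The fibre of `v` is a singleton, so a witness other than `v` keeps a different image.
      ... | no v∉Z with semitotal v (p─q⊆p D ⁅ y ⁆ v∈D-y)
      ... | u , u∈D , u≢v , vu = π u , ∈D′⁺ u∈D , πu≢πv , distance-image C vu
        where
        πu≢πv : π u ≢ π v
        πu≢πv eq with reflects eq
        ... | inj₁ u≡v       = u≢v u≡v
        ... | inj₂ (_ , v∈Z) = v∉Z v∈Z

    -- Choice of the collapsed set

    Collapsible : Set
    Collapsible = ∃[ Z ] ∃[ k ] k ≤ 3 × SpanningTree Z k ×
      (∃[ x ] ∃[ y ] x ∈ˡ Z × y ∈ˡ Z × x ∈ D × y ∈ D × x ≢ y) ×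
      (∃[ t ] ∃[ w ] t ∈ˡ Z × w ∉ˡ Z × w ∈ D × DistanceAtMost 2 t w)

    -- Each vertex is equal or adjacent to a vertex of `D`, which lies in `Z` or outside it. A walk
    -- from `x` to `w₀` starts in the first class and ends in the second, and the crossing gives `a`
    -- and the way to `w`.
    near-escape : Connected → ∀ {Z x w₀} → x ∈ˡ Z → x ∈ D → w₀ ∈ D → w₀ ∉ˡ Z →
                  ∃[ t ] ∃[ a ] ∃[ w ] t ∈ˡ Z × Near G t a ×
                    w ∈ D × w ∉ˡ Z × DistanceAtMost 2 a w
    near-escape connected {Z} {x} {w₀} x∈Z x∈D w₀∈D w₀∉Z
      with walk-crossing G owner (proj₂ (connected x w₀))
             (x , x∈Z , inj₁ refl) (w₀ , w₀∈D , w₀∉Z , inj₁ refl)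
      where
      owner : ∀ v → (∃[ t ] t ∈ˡ Z × Near G t v) ⊎ (∃[ w ] w ∈ D × w ∉ˡ Z × Near G v w)
      owner v = from-dominator dominator
        where
        dominator : ∃[ d ] d ∈ D × Near G v d
        dominator with v ∈? D
        ... | yes v∈D = v , v∈D , inj₁ refl
        ... | no  v∉D with dominating v v∉D
        ... | d , d∈D , vd = d , d∈D , inj₂ vd

        from-dominator : _ → _
        from-dominator (d , d∈D , near) with d ∈ˡ? Z
        ... | yes d∈Z = inj₁ (d , d∈Z , Near-sym G near)
        ... | no  d∉Z = inj₂ (d , d∈D , d∉Z , near)
    ... | a , b , (t , t∈Z , ta) , (w , w∈D , w∉Z , bw) , ab =
      t , a , w , t∈Z , ta , w∈D , w∉Z , Near⇒distance≤2 G ab bw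

    -- The bound `k ≤ 2` leaves room for the one edge that may be needed to absorb `a`.
    extend : Connected → ∀ {Z k x y w₀} → k ≤ 2 → SpanningTree Z k →
             x ∈ˡ Z → y ∈ˡ Z → x ∈ D → y ∈ D → x ≢ y → w₀ ∈ D → w₀ ∉ˡ Z → Collapsible
    extend connected {Z} {k} {x} {y} k≤2 T x∈Z y∈Z x∈D y∈D x≢y w₀∈D w₀∉Z
      with near-escape connected x∈Z x∈D w₀∈D w₀∉Z
    ... | t , a , w , t∈Z , ta , w∈D , w∉Z , aw = enlarge ta
      where
      stay : ∀ {t′} → t′ ∈ˡ Z → DistanceAtMost 2 t′ w → Collapsible
      stay t′∈Z t′w = Z , k , ℕ.m≤n⇒m≤1+n k≤2 , T
        , (x , y , x∈Z , y∈Z , x∈D , y∈D , x≢y) , (_ , w , t′∈Z , w∉Z , w∈D , t′w)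

      enlarge : Near G t a → Collapsible
      enlarge (inj₁ refl) = stay t∈Z aw
      enlarge (inj₂ ta) with a ∈ˡ? Z | w ≟ a
      ... | yes a∈Z | _        = stay a∈Z aw
      -- Here absorbing `a` would swallow the witness, but `a` is itself `w` and adjacent to `t`.
      ... | no  _   | yes refl = stay t∈Z (Near⇒distance≤2 G (inj₂ ta) (inj₁ refl))
      ... | no  a∉Z | no  w≢a  = a ∷ Z , suc k , s≤s k≤2 , grow T t∈Z a∉Z ta
        , (x , y , there x∈Z , there y∈Z , x∈D , y∈D , x≢y)
        , (a , w , here refl , (λ { (here eq) → w≢a eq ; (there w∈Z) → w∉Z w∈Z }) , w∈D , aw)

    module _ (connected : Connected) (2<∣D∣ : 2 < ∣ D ∣) where

      collapse-edge : ∀ {x y} → x ∈ D → y ∈ D → Adj x y → Collapsible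
      collapse-edge {x} {y} x∈D y∈D xy with 2<∣p∣⇒∃-third D 2<∣D∣ x y
      ... | w , w∈D , w≢x , w≢y =
        extend connected (s≤s z≤n)
          (grow (singleton x) (here refl) (λ { (here refl) → Adj⇒≢ xy refl }) xy)
          (there (here refl)) (here refl) x∈D y∈D (Adj⇒≢ xy) w∈D
          (λ { (here eq) → w≢y eq ; (there (here eq)) → w≢x eq })

      -- If `c` lies in `D`, then `x`, `c` and `y` might exhaust `D`; collapsing only the edge from
      -- `x` to `c` keeps a third vertex outside. If `c` is not in `D`, a third vertex of `D`
      -- automatically differs from `c`.
      collapse-path : ∀ {x c y} → x ∈ D → y ∈ D → x ≢ y → Adj x c → Adj c y → Collapsible
      collapse-path {x} {c} {y} x∈D y∈D x≢y xc cy with c ∈? D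
      ... | yes c∈D = collapse-edge x∈D c∈D xc
      ... | no  c∉D with 2<∣p∣⇒∃-third D 2<∣D∣ x y
      ... | w , w∈D , w≢x , w≢y =
        extend connected ℕ.≤-refl
          (grow (grow (singleton x) (here refl) (λ { (here refl) → Adj⇒≢ xc refl }) xc)
            (here refl)
            (λ { (here refl) → Adj⇒≢ cy refl ; (there (here refl)) → x≢y refl }) cy)
          (there (there (here refl))) (here refl) x∈D y∈D x≢y w∈D
          (λ { (here eq) → w≢y eq ; (there (here refl)) → c∉D w∈D
             ; (there (there (here eq))) → w≢x eq })

      collapsible : Collapsible
      collapsible with ∣q∣<∣p∣⇒∃∈p∉q D ⊥ (subst (_< ∣ D ∣) (sym (∣⊥∣≡0 n)) (ℕ.≤-<-trans z≤n 2<∣D∣))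
      ... | x , x∈D , _ with semitotal x x∈D
      ... | y , y∈D , y≢x , 0 , _ , here = contradiction refl y≢x
      ... | y , y∈D , y≢x , 1 , _ , step here xy = collapse-edge x∈D y∈D xy
      ... | y , y∈D , y≢x , 2 , _ , step (step here xc) cy =
        collapse-path x∈D y∈D (y≢x ∘ sym) xc cy
      ... | _ , _ , _ , suc (suc (suc _)) , s≤s (s≤s ()) , _

-- The bound on the contraction number.

theorem4 : ∀ {n} (G : Graph n) → Graph.Connected G →
    ∀ γ → IsSemitotalDominationNumber G γ → 3 ≤ γ →
    ∃[ k ] IsContractionNumber G k × k ≤ 3
theorem4 G connected _ isγ@((D , sd , refl) , _) 3≤γ
  -- The pattern `refl` has replaced `γ` by the size of a minimum set `D`, so `3≤γ` gives the third
  -- vertex of `D`, and any smaller set after contraction is a decrease.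
  with collapsible sd connected 3≤γ
... | Z , _ , k≤3 , T , (x , y , x∈Z , y∈Z , x∈D , y∈D , x≢y) , (t , w , t∈Z , w∉Z , w∈D , tw)
  with collapsed-dominating sd (SpanningTree.collapses T) x∈Z y∈Z x∈D y∈D x≢y t∈Z w∉Z w∈D tw
... | smaller
  with contractionNumber G isγ (SpanningTree.unique T) (decreases⁺ _ isγ smaller)
... | k , isk , k≤len = k , isk , ℕ.≤-trans k≤len (subst (_≤ 3) (sym (SpanningTree.size T)) k≤3)
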